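{- Let $k\geq 2$ be an integer. For integers $n\ge 0$ and $t\ge 0$ let $\mathrm{IB}_k(n,t)$ be the number of length-$n$ words over $\Sigma_k$ whose largest BP-factorization has width $t$. Then $\mathrm{IB}_k(0,0)=1$, and for every integer $n\geq 1$ we have $\mathrm{IB}_k(2n,2)=u_n$ and $\mathrm{IB}_k(n,1)=u_n$. Moreover, for all integers $n\geq 0$ and $t\geq 3$, \[ \mathrm{IB}_k(n,t)=\begin{cases} \sum_{i=1}^{(n-t)/2+1} u_{i}\, \mathrm{IB}_k(n-2i, t-2), & \text{if $n$, $t$ are both even;}\\ \sum_{i=1}^{(n-t+1)/2} u_{2i}\, \mathrm{IB}_k(n-2i,t-1), & \text{if $n$ is even and $t$ is odd;}\\ 0, & \text{if $n$ is odd and $t$ is even;}\\ \sum_{i=1}^{(n-t)/2+1}u_{2i-1}\,\mathrm{IB}_k(n-2i+1,t-1), & \text{if $n$, $t$ are both odd,} \end{cases} \] where a sum whose upper limit is less than $1$ is zero.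
   Context: $\Sigma_k=\{0,1,\ldots,k-1\}$. A border of a word $w$ is a non-empty word that is both a proper prefix and a proper suffix of $w$; $w$ is unbordered if it has no border (the empty word counts as unbordered). $u_n$ denotes the number of unbordered words of length $n$ over $\Sigma_k$; it satisfies $u_0=1$, $u_n=ku_{n-1}-u_{n/2}$ for even $n>0$, and $u_n=ku_{n-1}$ for odd $n$. A block palindrome factorization (BP-factorization) of a word $w$ is a factorization $w=w_m\cdots w_1w_0w_1\cdots w_m$ with $m\ge 0$, $w_0$ a possibly empty word and $w_1,\dots,w_m$ non-empty words. Its width is $2m+1$ if $w_0$ is non-empty and $2m$ if $w_0$ is empty (i.e., the number of non-empty blocks). A largest BP-factorization of $w$ is a BP-factorization of $w$ of maximum width; the width of the largest BP-factorization of $w$ is this maximum. -}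

module Defs where

open import Data.Empty using (⊥-elim)
open import Data.Fin using (Fin)
import Data.Fin.Properties as Fin
open import Data.List
  using (List; []; _∷_; _++_; _∷ʳ_; [_]; length; concat; reverse; take; drop; filter; allFin;
         applyUpTo; cartesianProductWith; initLast; _∷ʳ′_)
open import Data.List.Membership.Propositional using (_∈_)
open import Data.List.Membership.Propositional.Properties
  using (∈-allFin; ∈-cartesianProductWith⁺; ∈-cartesianProductWith⁻)
import Data.List.Properties as List
open import Data.List.Relation.Binary.Permutation.Propositional using (↭-sym)
open import Data.List.Relation.Binary.Permutation.Propositional.Properties using (All-resp-↭; ↭-reverse)
open import Data.List.Relation.Binary.Prefix.Heterogeneous as Prefix using (Prefix)
import Data.List.Relation.Binary.Prefix.Heterogeneous.Properties as Prefix
open import Data.List.Relation.Binary.Suffix.Heterogeneous using (Suffix)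
import Data.List.Relation.Binary.Suffix.Heterogeneous.Properties as Suffix
open import Data.List.Relation.Unary.All using (All; []; _∷_)
import Data.List.Relation.Unary.All.Properties as All
open import Data.List.Relation.Unary.Any using (here)
open import Data.List.Relation.Unary.Unique.Propositional using (Unique)
import Data.List.Relation.Unary.Unique.Propositional.Properties as Unique
import Data.List.Relation.Unary.AllPairs as AllPairs
open import Data.Nat
  using (ℕ; zero; suc; _+_; _*_; _≤_; _<_; z≤n; s≤s)
open import Data.Nat.ListAction using (sum)
open import Data.Nat.Properties as ℕ using (anyUpTo?; allUpTo?)
open import Data.Product using (Σ; ∃; ∃-syntax; _×_; _,_; proj₁; proj₂)
open import Function using (_∘_)
open import Relation.Binary.PropositionalEquality
  using (_≡_; _≢_; refl; sym; trans; cong; cong₂; subst; module ≡-Reasoning)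
open import Relation.Nullary using (¬_; Dec)
open import Relation.Nullary.Decidable using (map′; _×-dec_; _→-dec_; ¬?)
open import Relation.Unary using (Pred; Decidable)
open import Level using (0ℓ)

Word : ℕ → Set
Word k = List (Fin k)

infix 4 _≟ʷ_

_≟ʷ_ : ∀ {k} (v w : Word k) → Dec (v ≡ w)
_≟ʷ_ = List.≡-dec Fin._≟_

words : ∀ k → ℕ → List (Word k)
words k zero    = [ [] ]
words k (suc n) = cartesianProductWith _∷_ (allFin k) (words k n)

∈-words⁺ : ∀ {k} (w : Word k) → w ∈ words k (length w)
∈-words⁺ []      = here refl
∈-words⁺ (a ∷ w) = ∈-cartesianProductWith⁺ _∷_ (∈-allFin a) (∈-words⁺ w)

∈-words⁻ : ∀ {k} n {w : Word k} → w ∈ words k n → length w ≡ n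
∈-words⁻ zero    (here refl) = refl
∈-words⁻ {k} (suc n) w∈
  with _ , _ , _ , v∈ , refl ← ∈-cartesianProductWith⁻ _∷_ (allFin k) (words k n) w∈
  = cong suc (∈-words⁻ n v∈)

words-unique : ∀ k n → Unique (words k n)
words-unique k zero    = [] AllPairs.∷ AllPairs.[]
words-unique k (suc n) =
  Unique.cartesianProductWith⁺ _∷_ List.∷-injective (Unique.allFin⁺ k) (words-unique k n)

#words : ∀ k n {P : Pred (Word k) 0ℓ} → Decidable P → ℕ
#words k n P? = length (filter P? (words k n))

∑₁ : ℕ → (ℕ → ℕ) → ℕ
∑₁ N f = sum (applyUpTo (λ i → f (suc i)) N)

IsBorder : ∀ {k} → Word k → Word k → Set
IsBorder b w = b ≢ [] × b ≢ w × Prefix _≡_ b w × Suffix _≡_ b w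

Unbordered : ∀ {k} → Word k → Set
Unbordered w = ¬ (∃[ b ] IsBorder b w)

-- `blocks` lists w₁, …, w_m (innermost block first) and `core` is w₀.
record BPFactorization {k} (w : Word k) : Set where
  constructor bp
  field
    blocks    : List (Word k)
    core      : Word k
    nonEmpty  : All (_≢ []) blocks
    factorize : w ≡ concat (reverse blocks) ++ core ++ concat blocks

open BPFactorization public

coreWidth : ∀ {k} → Word k → ℕ
coreWidth []      = 0
coreWidth (_ ∷ _) = 1

width : ∀ {k} {w : Word k} → BPFactorization w → ℕ
width F = 2 * length (blocks F) + coreWidth (core F)

IsLargest : ∀ {k} {w : Word k} → BPFactorization w → Set
IsLargest {w = w} F = (G : BPFactorization w) → width G ≤ width F

LargestWidth : ∀ {k} → ℕ → Word k → Set
LargestWidth t w = Σ (BPFactorization w) λ F → IsLargest F × width F ≡ t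

take-length-++ : ∀ {A : Set} (xs ys : List A) → take (length xs) (xs ++ ys) ≡ xs
take-length-++ []       ys = refl
take-length-++ (x ∷ xs) ys = cong (x ∷_) (take-length-++ xs ys)

drop-length-++ : ∀ {A : Set} (xs ys : List A) → drop (length xs) (xs ++ ys) ≡ ys
drop-length-++ []       ys = refl
drop-length-++ (x ∷ xs) ys = drop-length-++ xs ys

prefix⇒take : ∀ {A : Set} {xs ys : List A} → Prefix _≡_ xs ys → take (length xs) ys ≡ xs
prefix⇒take Prefix.[]            = refl
prefix⇒take (refl Prefix.∷ p) = cong (_ ∷_) (prefix⇒take p)

isBorder? : ∀ {k} (b w : Word k) → Dec (IsBorder b w)
isBorder? b w =
  ¬? (b ≟ʷ []) ×-dec ¬? (b ≟ʷ w) ×-dec Prefix.prefix? Fin._≟_ b w ×-dec Suffix.suffix? Fin._≟_ b w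

unbordered? : ∀ {k} → Decidable (Unbordered {k})
unbordered? w = ¬? (map′ to from (anyUpTo? (λ i → isBorder? (take i w) w) (suc (length w))))
  where
  to : (∃ λ i → i < suc (length w) × IsBorder (take i w) w) → ∃[ b ] IsBorder b w
  to (i , _ , p) = take i w , p
  from : (∃[ b ] IsBorder b w) → ∃ λ i → i < suc (length w) × IsBorder (take i w) w
  from (b , p@(_ , _ , pre , _)) =
    length b , s≤s (Prefix.length-mono pre) ,
    subst (λ v → IsBorder v w) (sym (prefix⇒take pre)) p

concat-reverse-∷ʳ : ∀ {A : Set} (bs : List (List A)) x →
                    concat (reverse (bs ∷ʳ x)) ≡ x ++ concat (reverse bs)
concat-reverse-∷ʳ bs x = cong concat (List.reverse-++ bs [ x ])

concat-∷ʳ : ∀ {A : Set} (bs : List (List A)) x → concat (bs ∷ʳ x) ≡ concat bs ++ x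
concat-∷ʳ bs x =
  trans (sym (List.concat-++ bs [ x ])) (cong (concat bs ++_) (List.++-identityʳ x))

peel : ∀ {A : Set} (bs : List (List A)) x c →
       concat (reverse (bs ∷ʳ x)) ++ c ++ concat (bs ∷ʳ x)
         ≡ x ++ (concat (reverse bs) ++ c ++ concat bs) ++ x
peel bs x c = begin
  concat (reverse (bs ∷ʳ x)) ++ c ++ concat (bs ∷ʳ x)
    ≡⟨ cong₂ (λ l r → l ++ c ++ r) (concat-reverse-∷ʳ bs x) (concat-∷ʳ bs x) ⟩
  (x ++ L) ++ c ++ (R ++ x)
    ≡⟨ List.++-assoc x L _ ⟩
  x ++ L ++ c ++ R ++ x
    ≡⟨ cong (λ z → x ++ L ++ z) (List.++-assoc c R x) ⟨
  x ++ L ++ (c ++ R) ++ x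
    ≡⟨ cong (x ++_) (List.++-assoc L (c ++ R) x) ⟨
  x ++ (L ++ c ++ R) ++ x ∎
  where
  open ≡-Reasoning
  L = concat (reverse bs)
  R = concat bs

module _ {k} {Q : Pred (Word k) 0ℓ} (Q? : Decidable Q) where

  Factors : ℕ → Word k → Set
  Factors m w = Σ (BPFactorization w) λ F → length (blocks F) ≡ m × Q (core F)

  private
    Peeled : ℕ → Word k → ℕ → ℕ → Set
    Peeled m w i j = x ≢ [] × w ≡ x ++ v ++ x × Factors m v
      where
      x = take i w
      v = take j (drop i w)

    join : ∀ {m w x v} → x ≢ [] → w ≡ x ++ v ++ x → Factors m v → Factors (suc m) w
    join {x = x} x≢[] eq (bp bs c ne refl , refl , q) =
      bp (bs ∷ʳ x) c (All.++⁺ ne (x≢[] ∷ [])) (trans eq (sym (peel bs x c))) ,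
      trans (List.length-++ bs) (ℕ.+-comm _ 1) , q

    split : ∀ {m w} → Factors (suc m) w →
            ∃ λ i → i < suc (length w) × ∃ λ j → j < suc (length w) × Peeled m w i j
    split (bp bs c ne eq , len , q) with initLast bs
    split (bp .(bs ∷ʳ x) c ne eq , len , q) | bs ∷ʳ′ x =
      length x , s≤s lx , length v , s≤s lv ,
      subst (_≢ []) (sym x≡) (proj₂ (All.∷ʳ⁻ ne)) ,
      trans w≡ (cong₂ (λ a b → a ++ b ++ a) (sym x≡) (sym v≡)) ,
      subst (Factors _) (sym v≡)
        (bp bs c (proj₁ (All.∷ʳ⁻ ne)) refl ,
         ℕ.suc-injective (trans (sym (trans (List.length-++ bs) (ℕ.+-comm _ 1))) len) , q)
      where
      v  = concat (reverse bs) ++ c ++ concat bs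
      w≡ = trans eq (peel bs x c)
      x≡ = trans (cong (take (length x)) w≡) (take-length-++ x (v ++ x))
      v≡ = trans (cong (take (length v) ∘ drop (length x)) w≡)
             (trans (cong (take (length v)) (drop-length-++ x (v ++ x))) (take-length-++ v x))
      len≡ = trans (cong length w≡)
               (trans (List.length-++ x) (cong (length x +_) (List.length-++ v)))
      lx = ℕ.≤-trans (ℕ.m≤m+n _ _) (ℕ.≤-reflexive (sym len≡))
      lv = ℕ.≤-trans (ℕ.≤-trans (ℕ.m≤m+n (length v) (length x)) (ℕ.m≤n+m _ (length x)))
             (ℕ.≤-reflexive (sym len≡))

  factors? : ∀ m → Decidable (Factors m)
  factors? zero w = map′
    (λ q → bp [] w [] (sym (List.++-identityʳ w)) , refl , q)
    (λ { (bp [] c _ eq , _ , q) → subst Q (sym (trans eq (List.++-identityʳ c))) q })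
    (Q? w)
  factors? (suc m) w = map′
    (λ { (_ , _ , _ , _ , x≢[] , eq , F) → join x≢[] eq F })
    split
    (anyUpTo? (λ i → anyUpTo? (λ j →
        ¬? (take i w ≟ʷ [])
        ×-dec w ≟ʷ take i w ++ take j (drop i w) ++ take i w
        ×-dec factors? m (take j (drop i w)))
      (suc (length w))) (suc (length w)))

HasWidth : ∀ {k} → ℕ → Word k → Set
HasWidth t w = Σ (BPFactorization w) λ F → width F ≡ t

hasWidth? : ∀ {k} t → Decidable (HasWidth {k} t)
hasWidth? t w = map′
  (λ { (m , _ , F , refl , q) → F , q })
  (λ { (F , q) → length (blocks F) ,
       s≤s (ℕ.≤-trans (ℕ.m≤m+n _ _) (ℕ.≤-trans (ℕ.m≤m+n _ _) (ℕ.≤-reflexive q))) ,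
       F , refl , q })
  (anyUpTo? (λ m → factors? (λ c → 2 * m + coreWidth c ℕ.≟ t) m w) (suc t))

length≤length-concat : ∀ {A : Set} {bs : List (List A)} → All (_≢ []) bs →
                       length bs ≤ length (concat bs)
length≤length-concat []                            = z≤n
length≤length-concat {bs = [] ∷ _}      (ne ∷ _)   = ⊥-elim (ne refl)
length≤length-concat {bs = (x ∷ b) ∷ bs} (_ ∷ nes) = s≤s (ℕ.≤-trans (length≤length-concat nes)
  (ℕ.≤-trans (ℕ.m≤n+m _ (length b)) (ℕ.≤-reflexive (sym (List.length-++ b)))))

coreWidth≤length : ∀ {k} (c : Word k) → coreWidth c ≤ length c
coreWidth≤length []      = z≤n
coreWidth≤length (_ ∷ _) = s≤s z≤n

width≤length : ∀ {k} {w : Word k} (F : BPFactorization w) → width F ≤ length w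
width≤length {w = w} (bp bs c ne eq) = begin
  2 * length bs + coreWidth c
    ≡⟨ cong (λ z → length bs + z + coreWidth c) (ℕ.+-identityʳ (length bs)) ⟩
  length bs + length bs + coreWidth c
    ≡⟨ ℕ.+-assoc (length bs) _ _ ⟩
  length bs + (length bs + coreWidth c)
    ≡⟨ cong (length bs +_) (ℕ.+-comm (length bs) _) ⟩
  length bs + (coreWidth c + length bs)
    ≡⟨ cong (_+ (coreWidth c + length bs)) (List.length-reverse bs) ⟨
  length (reverse bs) + (coreWidth c + length bs)
    ≤⟨ ℕ.+-mono-≤ (length≤length-concat (All-resp-↭ (↭-sym (↭-reverse bs)) ne))
         (ℕ.+-mono-≤ (coreWidth≤length c) (length≤length-concat ne)) ⟩
  length (concat (reverse bs)) + (length c + length (concat bs))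
    ≡⟨ cong (length (concat (reverse bs)) +_) (List.length-++ c) ⟨
  length (concat (reverse bs)) + length (c ++ concat bs)
    ≡⟨ List.length-++ (concat (reverse bs)) ⟨
  length (concat (reverse bs) ++ c ++ concat bs)
    ≡⟨ cong length eq ⟨
  length w ∎
  where open ℕ.≤-Reasoning

largestWidth? : ∀ {k} t → Decidable (LargestWidth {k} t)
largestWidth? t w = map′
  (λ { ((F , refl) , max) → F , (λ G → max (s≤s (width≤length G)) (G , refl)) , refl })
  (λ { (F , max , refl) → (F , refl) , λ { _ (G , refl) → max G } })
  (hasWidth? t w ×-dec
   allUpTo? (λ s → hasWidth? s w →-dec s ℕ.≤? t) (suc (length w)))

u : ℕ → ℕ → ℕ
u k n = #words k n unbordered?

IB : ℕ → ℕ → ℕ → ℕ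
IB k n t = #words k n (largestWidth? t)

{-# OPTIONS --safe #-}
module Submission where

-- If b is the shortest border of w then b is unbordered and w = b v b.  Another outer block x of w
-- would be of the form b y b, and cutting it at b gives a factorization of v that is at least as
-- wide as the given one of w; hence the largest factorization peels off b and continues with v.
-- This makes the largest factorization unique, with all blocks unbordered, and yields the recursion
--   IB(n, t + 2) = Σ_{i ≥ 1} u_i IB(n - 2i, t)   for all t ≥ 0,
-- a convolution in ⌊n/2⌋ for each parity of n.  For odd widths, the factor counting the core starts
-- innermost and is moved outermost by commutativity and associativity of convolution.

open import Defs
open import Data.Nat using (ℕ; zero; suc; _+_; _*_; _∸_; _≤_; _<_; _/_; z≤n; s≤s)
open import Data.Nat.Divisibility using (_∣_; _∤_; divides)
open import Data.Nat.DivMod using (m*n/n≡m)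
open import Data.Nat.ListAction using (sum)
open import Data.Nat.Properties
open import Data.Nat.Tactic.RingSolver using (solve-∀)
open import Data.List
  using (List; []; _∷_; _++_; [_]; length; map; concat; reverse; take; filter;
         applyUpTo; cartesianProduct)
open import Data.List.Properties
  using (∷-injective; ++-assoc; ++-identityʳ; ++-identityʳ-unique; ++-cancelˡ; ++-cancelʳ;
         ++-conicalˡ; ++-conicalʳ; length-++; length-++-≤ˡ; length-++-≤ʳ; length-map;
         filter-none; filter-accept)
open import Data.List.Membership.Propositional using (_∈_)
open import Data.List.Membership.Propositional.Properties
  using (∈-map⁺; ∈-map⁻; ∈-filter⁺; ∈-filter⁻; ∈-concat⁺′; ∈-concat⁻′; ∈-applyUpTo⁺; ∈-applyUpTo⁻;
         ∈-cartesianProduct⁺; ∈-cartesianProduct⁻)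
open import Data.List.Membership.Propositional.Properties.WithK using (unique∧set⇒bag)
open import Data.List.Relation.Binary.BagAndSetEquality using (∼bag⇒↭)
open import Data.List.Relation.Binary.Permutation.Propositional.Properties using (↭-length)
open import Data.List.Relation.Binary.Pointwise using (Pointwise-≡⇒≡; ≡⇒Pointwise-≡)
import Data.List.Relation.Binary.Prefix.Heterogeneous as Prefix
import Data.List.Relation.Binary.Prefix.Heterogeneous.Properties as Prefix
import Data.List.Relation.Binary.Suffix.Heterogeneous as Suffix
open import Data.List.Relation.Unary.All as All using (All; []; _∷_)
import Data.List.Relation.Unary.All.Properties as All
open import Data.List.Relation.Unary.AllPairs using ([]; _∷_)
import Data.List.Relation.Unary.AllPairs.Properties as AllPairs
open import Data.List.Relation.Unary.Any using (here; there)
open import Data.List.Relation.Unary.Unique.Propositional using (Unique)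
import Data.List.Relation.Unary.Unique.Propositional.Properties as Unique
open import Data.List.Reverse using (Reverse; []; _∶_∶ʳ_; reverseView)
open import Data.Product using (∃-syntax; _×_; _,_; proj₁; proj₂)
open import Data.Product.Properties using (×-≡,≡→≡)
open import Data.Sum using (_⊎_; inj₁; inj₂)
open import Function using (_∘_; id; mk⇔)
open import Level using (0ℓ)
open import Relation.Binary.PropositionalEquality
  using (_≡_; _≢_; refl; sym; trans; cong; cong₂; subst; module ≡-Reasoning)
open import Relation.Nullary using (¬_; yes; no; contradiction)
open import Relation.Nullary.Decidable using (_×-dec_; ¬?)
open import Relation.Unary using (Pred; Decidable)

private variable
  A B : Set
  k s t : ℕ

-- Affixes and unbordered words

levi : (xs us : List A) {ys vs : List A} → xs ++ ys ≡ us ++ vs →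
       (∃[ z ] us ≡ xs ++ z × ys ≡ z ++ vs) ⊎ (∃[ z ] xs ≡ us ++ z × vs ≡ z ++ ys)
levi []       us       eq = inj₁ (us , refl , eq)
levi (x ∷ xs) []       eq = inj₂ (x ∷ xs , refl , sym eq)
levi (x ∷ xs) (v ∷ us) eq with refl , eq′ ← ∷-injective eq with levi xs us eq′
... | inj₁ (z , refl , q) = inj₁ (z , refl , q)
... | inj₂ (z , refl , q) = inj₂ (z , refl , q)

-- A border without the two inequalities, given by explicit complements: admitting the empty word
-- and `w` itself makes the relation reflexive and transitive.
Affix : List A → List A → Set
Affix b w = (∃[ z ] w ≡ b ++ z) × (∃[ z ] w ≡ z ++ b)

affix-refl : {w : List A} → Affix w w
affix-refl {w = w} = ([] , sym (++-identityʳ w)) , ([] , refl)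

affix-trans : {b c w : List A} → Affix b c → Affix c w → Affix b w
affix-trans {b = b} ((x , refl) , (x′ , p)) ((y , refl) , (y′ , q)) =
  (x ++ y , ++-assoc b x y) ,
  (y′ ++ x′ , trans q (trans (cong (y′ ++_) p) (sym (++-assoc y′ x′ b))))

affix-sandwich : (b v : List A) → Affix b (b ++ v ++ b)
affix-sandwich b v = (v ++ b , refl) , (b ++ v , sym (++-assoc b v b))

prefix-≤ : (xs us : List A) {ys vs : List A} → xs ++ ys ≡ us ++ vs →
           length xs ≤ length us → ∃[ z ] us ≡ xs ++ z
prefix-≤ []       us       eq le       = us , refl
prefix-≤ (x ∷ xs) (v ∷ us) eq (s≤s le) with refl , eq′ ← ∷-injective eq
  with z , refl ← prefix-≤ xs us eq′ le = z , refl

suffix-≤ : (xs us : List A) {ys vs : List A} → xs ++ ys ≡ us ++ vs →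
           length ys ≤ length vs → ∃[ z ] vs ≡ z ++ ys
suffix-≤ xs us eq le with levi xs us eq
... | inj₁ ([]    , _ , refl)      = [] , refl
... | inj₁ (x ∷ z , _ , refl)      = contradiction (≤-trans le (length-++-≤ʳ _ {xs = z})) (n≮n _)
... | inj₂ (z     , _ , q)         = z , q

affix-≤ : {b c w : List A} → Affix b w → Affix c w → length b ≤ length c → Affix b c
affix-≤ {b = b} {c} ((_ , p) , (x , q)) ((_ , p′) , (y , q′)) le =
  prefix-≤ b c (trans (sym p) p′) le , suffix-≤ x y (trans (sym q) q′) le

affix-< : {c w : List A} → Affix c w → c ≢ w → length c < length w
affix-< {c = c} (([]    , refl) , _) c≢w = contradiction (sym (++-identityʳ c)) c≢w
affix-< {c = c} ((x ∷ z , refl) , _) c≢w = begin-strict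
  length c                  <⟨ m<m+n (length c) (s≤s z≤n) ⟩
  length c + length (x ∷ z) ≡⟨ length-++ c ⟨
  length (c ++ x ∷ z)       ∎
  where open ≤-Reasoning

border⇒affix : {b w : Word k} → IsBorder b w → Affix b w
border⇒affix (_ , _ , pre , suf) with Prefix.toView pre | Suffix.toView suf
... | p Prefix.++ ds | v = (ds , cong (_++ ds) (sym (Pointwise-≡⇒≡ p))) , suffix v
  where
  suffix : ∀ {b w : Word k} → Suffix.SuffixView _≡_ b w → ∃[ z ] w ≡ z ++ b
  suffix (cs Suffix.++ p) = cs , cong (cs ++_) (sym (Pointwise-≡⇒≡ p))

affix⇒border : {b w : Word k} → b ≢ [] → b ≢ w → Affix b w → IsBorder b w
affix⇒border b≢[] b≢w ((x , refl) , (y , q)) =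
  b≢[] , b≢w ,
  Prefix.fromView (≡⇒Pointwise-≡ refl Prefix.++ x) ,
  subst (Suffix.Suffix _≡_ _) (sym q) (Suffix.fromView (y Suffix.++ ≡⇒Pointwise-≡ refl))

-- `unbordered?` decides a negation, so its negative answer carries no border; the search over
-- prefixes is repeated here to obtain one.
unbordered⊎bordered : (w : Word k) → Unbordered w ⊎ ∃[ b ] IsBorder b w
unbordered⊎bordered w with anyUpTo? (λ i → isBorder? (take i w) w) (suc (length w))
... | yes (i , _ , p) = inj₂ (take i w , p)
... | no ¬p           = inj₁ λ (b , p@(_ , _ , pre , _)) →
  ¬p (length b , s≤s (Prefix.length-mono pre) ,
      subst (λ v → IsBorder v w) (sym (prefix⇒take pre)) p)

Block : Word k → Set
Block w = w ≢ [] × Unbordered w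

block? : Decidable (Block {k})
block? w = ¬? (w ≟ʷ []) ×-dec unbordered? w

affix-of-block : {b c : Word k} → Block c → b ≢ [] → Affix b c → b ≡ c
affix-of-block {b = b} {c} (_ , unb) b≢[] aff with b ≟ʷ c
... | yes eq = eq
... | no b≢c = contradiction (b , affix⇒border b≢[] b≢c aff) unb

-- The shorter of the two is a non-empty affix of the longer, and an unbordered word has no such
-- affix except itself.
blockAffix-unique : {b c w : Word k} → Block b → Block c → Affix b w → Affix c w → b ≡ c
blockAffix-unique {b = b} {c} B C p q with ≤-total (length b) (length c)
... | inj₁ le = affix-of-block C (proj₁ B) (affix-≤ p q le)
... | inj₂ le = sym (affix-of-block B (proj₁ C) (affix-≤ q p le))

-- The prefix and the suffix b cannot overlap partially, as the overlap would be a border of b.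
blockAffix-split : {b w : Word k} → Block b → Affix b w → w ≡ b ⊎ (∃[ y ] w ≡ b ++ y ++ b)
blockAffix-split {b = b} B ((z , refl) , (z′ , q)) with levi b z′ q
... | inj₁ (y , _ , refl)              = inj₂ (y , refl)
... | inj₂ ([] , _ , refl)             = inj₂ ([] , refl)
... | inj₂ (y@(_ ∷ _) , b≡z′y , b≡yz)
  with refl ← affix-of-block B (λ ()) ((z , b≡yz) , (z′ , b≡z′y))
  with refl ← ++-identityʳ-unique y b≡yz = inj₁ (++-identityʳ y)

-- Passing to a border of a border ends at an unbordered word, since borders are strictly shorter;
-- `n` is the fuel for this descent.
blockAffix-exists : ∀ n (w : Word k) → length w ≤ n → w ≢ [] → ∃[ b ] Block b × Affix b w
blockAffix-exists zero    []      z≤n w≢[] = contradiction refl w≢[]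
blockAffix-exists (suc n) w       le  w≢[] with unbordered⊎bordered w
... | inj₁ unb = w , (w≢[] , unb) , affix-refl
... | inj₂ (c , bord@(c≢[] , c≢w , _))
  with b , B , aff ← blockAffix-exists n c
                       (≤-pred (≤-trans (affix-< (border⇒affix bord) c≢w) le)) c≢[]
  = b , B , affix-trans aff (border⇒affix bord)

-- Largest factorizations

-- Arbitrary BP-factorizations, indexed by width and built around the core so that the outermost
-- pair of blocks is exposed for induction.
data Nested {k} : ℕ → Word k → Set where
  bare : ∀ c → Nested (coreWidth c) c
  wrap : ∀ {x v w} → x ≢ [] → Nested s v → w ≡ x ++ v ++ x → Nested (2 + s) w

nested⇒bp : {w : Word k} → Nested t w → ∃[ F ] width {w = w} F ≡ t
nested⇒bp (bare c) = bp [] c [] (sym (++-identityʳ c)) , refl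
nested⇒bp (wrap {x = x} x≢[] N refl) with bp bs c ne refl , refl ← nested⇒bp N =
  bp (bs ++ [ x ]) c (All.++⁺ ne (x≢[] ∷ [])) (sym (peel bs x c)) ,
  cong (_+ coreWidth c) (begin
    2 * length (bs ++ [ x ]) ≡⟨ cong (2 *_) (trans (length-++ bs) (+-comm _ 1)) ⟩
    2 * suc (length bs)      ≡⟨ *-suc 2 (length bs) ⟩
    2 + 2 * length bs        ∎)
  where open ≡-Reasoning

nested-resp : {w : Word k} → s ≡ t → Nested s w → Nested t w
nested-resp refl N = N

-- The outermost block is the last entry of `blocks`, so the recursion runs along the reverse view
-- of the list.
bp⇒nested : {w : Word k} (F : BPFactorization w) → Nested (width F) w
bp⇒nested (bp bs c ne refl) = go (reverseView bs) ne
  where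
  go : ∀ {bs} → Reverse bs → All (_≢ []) bs →
       Nested (2 * length bs + coreWidth c) (concat (reverse bs) ++ c ++ concat bs)
  go [] _ = subst (Nested (coreWidth c)) (sym (++-identityʳ c)) (bare c)
  go (bs ∶ rs ∶ʳ x) ne =
    nested-resp
      (cong (_+ coreWidth c) (trans (sym (*-suc 2 (length bs)))
                                    (cong (2 *_) (sym (trans (length-++ bs) (+-comm _ 1))))))
      (wrap (proj₂ (All.∷ʳ⁻ ne)) (go rs (proj₁ (All.∷ʳ⁻ ne))) (peel bs x c))

-- The canonical factorization: every outer block is unbordered, and the core is empty or
-- unbordered. It turns out to be the largest one.
data Peeling {k} : ℕ → Word k → Set where
  empty : Peeling 0 []
  block : ∀ {w} → Block w → Peeling 1 w
  wrap  : ∀ {b v w} → Block b → Peeling t v → w ≡ b ++ v ++ b → Peeling (2 + t) w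

peeling⇒nested : {w : Word k} → Peeling t w → Nested t w
peeling⇒nested empty                       = bare []
peeling⇒nested (block {[]}    (w≢[] , _))  = contradiction refl w≢[]
peeling⇒nested (block {a ∷ w} _)           = bare (a ∷ w)
peeling⇒nested (wrap B P eq)               = wrap (proj₁ B) (peeling⇒nested P) eq

sandwich-≢ : (x v : List A) → x ≢ [] → x ≢ x ++ v ++ x
sandwich-≢ x v x≢[] eq = x≢[] (++-conicalʳ v x (++-identityʳ-unique x eq))

-- A non-empty `y` contributes a further pair of blocks and an empty `y` contributes none, so the
-- width is only bounded from below.
wrapCore : ∀ {x v : Word k} → x ≢ [] → Nested s v → ∀ y →
           ∃[ s′ ] 2 + s ≤ s′ × Nested s′ (y ++ (x ++ v ++ x) ++ y)
wrapCore x≢[] N []        =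
  _ , ≤-refl , subst (Nested _) (sym (++-identityʳ _)) (wrap x≢[] N refl)
wrapCore x≢[] N y@(_ ∷ _) =
  _ , m≤n+m _ 2 , wrap {x = y} (λ ()) (wrap x≢[] N refl) refl

sandwich-injective : {b c v v′ : Word k} → Block b → Block c →
                     b ++ v ++ b ≡ c ++ v′ ++ c → b ≡ c × v ≡ v′
sandwich-injective {b = b} {c} {v} {v′} B C eq
  with refl ← blockAffix-unique B C (affix-sandwich b v)
                (subst (Affix c) (sym eq) (affix-sandwich c v′))
  = refl , ++-cancelʳ b v v′ (++-cancelˡ b _ _ eq)

coreWidth≤1 : (c : Word k) → coreWidth c ≤ 1
coreWidth≤1 []      = z≤n
coreWidth≤1 (_ ∷ _) = s≤s z≤n

-- An outer block x ≠ b must be b ++ y ++ b; moving the cut to b leaves the factorization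
-- y , b , … , b , y of the inside, which is at least as wide as the original one.
nested≤peeling : {w : Word k} → Nested s w → Peeling t w → s ≤ t
nested≤peeling (bare c) empty        = z≤n
nested≤peeling (bare c) (block _)    = coreWidth≤1 c
nested≤peeling (bare c) (wrap _ _ _) = ≤-trans (coreWidth≤1 c) (s≤s z≤n)
nested≤peeling (wrap {x = x} x≢[] N eq) empty =
  contradiction (++-conicalˡ x _ (sym eq)) x≢[]
nested≤peeling (wrap {x = x} {v} x≢[] N refl) (block W) =
  contradiction (affix-of-block W x≢[] (affix-sandwich x v)) (sandwich-≢ x v x≢[])
nested≤peeling (wrap {x = x} {v} x≢[] N refl) (wrap {b = b} {v′} B P eq)
  with ≤-total (length x) (length b)
... | inj₁ le
  with refl ← affix-of-block B x≢[] (affix-≤ (affix-sandwich x v)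
                (subst (Affix b) (sym eq) (affix-sandwich b v′)) le)
  with refl ← ++-cancelʳ b v v′ (++-cancelˡ b _ _ eq)
  = s≤s (s≤s (nested≤peeling N P))
... | inj₂ le
  with blockAffix-split B (affix-≤ (subst (Affix b) (sym eq) (affix-sandwich b v′))
                             (affix-sandwich x v) le)
... | inj₁ refl with refl ← ++-cancelʳ b v v′ (++-cancelˡ b _ _ eq)
  = s≤s (s≤s (nested≤peeling N P))
... | inj₂ (y , refl) with s′ , le′ , N′ ← wrapCore (proj₁ B) N y =
  ≤-trans le′ (m≤n⇒m≤o+n 2 (nested≤peeling (subst (Nested s′) inner≡ N′) P))
  where
  inner≡ : y ++ (b ++ v ++ b) ++ y ≡ v′
  inner≡ = ++-cancelʳ b _ v′ (++-cancelˡ b _ _ (begin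
    b ++ (y ++ (b ++ v ++ b) ++ y) ++ b
      ≡⟨ cong (b ++_) (++-assoc y _ b) ⟩
    b ++ y ++ ((b ++ v ++ b) ++ y) ++ b
      ≡⟨ cong (λ z → b ++ y ++ z) (trans (++-assoc (b ++ v ++ b) y b)
           (trans (++-assoc b (v ++ b) _) (cong (b ++_) (++-assoc v b _)))) ⟩
    b ++ y ++ b ++ v ++ b ++ y ++ b
      ≡⟨ trans (++-assoc b (y ++ b) _) (cong (b ++_) (++-assoc y b _)) ⟨
    (b ++ y ++ b) ++ v ++ b ++ y ++ b
      ≡⟨ eq ⟩
    b ++ v′ ++ b ∎))
    where open ≡-Reasoning

sandwich-< : (b y : List A) → b ≢ [] → length y < length (b ++ y ++ b)
sandwich-< []      y b≢[] = contradiction refl b≢[]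
sandwich-< (x ∷ b) y _    = s≤s (≤-trans (length-++-≤ˡ y) (length-++-≤ʳ _ {xs = b}))

-- An unbordered affix `b` of a non-empty word is either the whole word, which is then the core, or
-- a pair of outer blocks around a shorter word.
peeling-exists : ∀ n (w : Word k) → length w ≤ n → ∃[ t ] Peeling t w
peeling-exists n       []        _  = 0 , empty
peeling-exists (suc n) w@(_ ∷ _) le with blockAffix-exists (suc n) w le (λ ())
... | b , B , aff with blockAffix-split B aff
... | inj₁ w≡b       = 1 , block (subst Block (sym w≡b) B)
... | inj₂ (y , w≡)
  with t , P ← peeling-exists n y (≤-pred (≤-trans
         (subst (λ z → length y < length z) (sym w≡) (sandwich-< b y (proj₁ B))) le))
  = 2 + t , wrap B P w≡

peeling⇒largest : {w : Word k} → Peeling t w → LargestWidth t w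
peeling⇒largest P with F , refl ← nested⇒bp (peeling⇒nested P) =
  F , (λ G → nested≤peeling (bp⇒nested G) P) , refl

-- Some peeling of `w` exists. It is itself a factorization, so its width is at most the maximum,
-- and it bounds the width of every factorization.
largest⇒peeling : {w : Word k} → LargestWidth t w → Peeling t w
largest⇒peeling {w = w} (F , max , refl) with t , P ← peeling-exists _ w ≤-refl
  with G , refl ← nested⇒bp (peeling⇒nested P)
  = subst (λ t → Peeling t w) (≤-antisym (max G) (nested≤peeling (bp⇒nested F) P)) P

-- An even width rules out a non-empty core, and each pair of equal blocks has even total length.
peeling-parity : ∀ m {w : Word k} → Peeling (m * 2) w → 2 ∣ length w
peeling-parity zero    empty = divides 0 refl
peeling-parity (suc m) (wrap {b = b} {v} _ P refl) with divides q eq ← peeling-parity m P =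
  divides (length b + q) (begin
    length (b ++ v ++ b)             ≡⟨ length-++ b ⟩
    length b + length (v ++ b)       ≡⟨ cong (length b +_) (length-++ v) ⟩
    length b + (length v + length b) ≡⟨ cong (λ z → length b + (z + length b)) eq ⟩
    length b + (q * 2 + length b)    ≡⟨ lemma (length b) q ⟩
    (length b + q) * 2               ∎)
  where
  open ≡-Reasoning
  lemma : ∀ b q → b + (q * 2 + b) ≡ (b + q) * 2
  lemma = solve-∀

-- Counting

-- Duplicate-free lists with the same members are permutations of each other. Injectivity is asked
-- for on `xs` only, because gluing `b ++ v ++ b` is injective for unbordered `b` but not in
-- general.
length-bijection : {xs : List A} {ys : List B} (f : A → B) → Unique xs → Unique ys →
                   (∀ {x y} → x ∈ xs → y ∈ xs → f x ≡ f y → x ≡ y) →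
                   (∀ {x} → x ∈ xs → f x ∈ ys) →
                   (∀ {y} → y ∈ ys → ∃[ x ] x ∈ xs × y ≡ f x) →
                   length xs ≡ length ys
length-bijection {xs = xs} {ys} f xs! ys! inj into onto = begin
  length xs          ≡⟨ length-map f xs ⟨
  length (map f xs)  ≡⟨ ↭-length (∼bag⇒↭ (unique∧set⇒bag (map-unique xs! inj) ys! (mk⇔ to from))) ⟩
  length ys          ∎
  where
  open ≡-Reasoning
  map-unique : ∀ {xs} → Unique xs → (∀ {x y} → x ∈ xs → y ∈ xs → f x ≡ f y → x ≡ y) →
               Unique (map f xs)
  map-unique []         inj = []
  map-unique (x∉ ∷ xs!) inj =
    All.map⁺ (All.tabulate λ y∈ eq → All.lookup x∉ y∈ (inj (here refl) (there y∈) eq))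
    ∷ map-unique xs! λ x∈ y∈ → inj (there x∈) (there y∈)
  to : ∀ {y} → y ∈ map f xs → y ∈ ys
  to y∈ with _ , x∈ , refl ← ∈-map⁻ f y∈ = into x∈
  from : ∀ {y} → y ∈ ys → y ∈ map f xs
  from y∈ with _ , x∈ , refl ← onto y∈ = ∈-map⁺ f x∈

length-cartesianProduct : (xs : List A) (ys : List B) →
                          length (cartesianProduct xs ys) ≡ length xs * length ys
length-cartesianProduct []       ys = refl
length-cartesianProduct (x ∷ xs) ys = trans (length-++ (map (x ,_) ys))
  (cong₂ _+_ (length-map (x ,_) ys) (length-cartesianProduct xs ys))

length-concat-applyUpTo : (f : ℕ → List A) (n : ℕ) →
                          length (concat (applyUpTo f n)) ≡ sum (applyUpTo (length ∘ f) n)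
length-concat-applyUpTo f zero    = refl
length-concat-applyUpTo f (suc n) =
  trans (length-++ (f 0)) (cong (length (f 0) +_) (length-concat-applyUpTo (f ∘ suc) n))

sum-cong : ∀ {f g : ℕ → ℕ} n → (∀ i → i < n → f i ≡ g i) →
           sum (applyUpTo f n) ≡ sum (applyUpTo g n)
sum-cong zero    eq = refl
sum-cong (suc n) eq = cong₂ _+_ (eq 0 (s≤s z≤n)) (sum-cong n λ i i<n → eq (suc i) (s≤s i<n))

sum-truncate : ∀ {f : ℕ → ℕ} {m n} → m ≤ n → (∀ i → m ≤ i → i < n → f i ≡ 0) →
               sum (applyUpTo f n) ≡ sum (applyUpTo f m)
sum-truncate {n = zero}  z≤n       f≡0 = refl
sum-truncate {n = suc n} z≤n       f≡0 =
  cong₂ _+_ (f≡0 0 z≤n (s≤s z≤n)) (sum-truncate {n = n} z≤n λ i _ i<n → f≡0 (suc i) z≤n (s≤s i<n))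
sum-truncate             (s≤s m≤n) f≡0 =
  cong (_ +_) (sum-truncate m≤n λ i m≤i i<n → f≡0 (suc i) (s≤s m≤i) (s≤s i<n))

-- Convolution of sequences

infixr 7 _⋆_

-- The Cauchy product, that is, multiplication of the generating functions.
_⋆_ : (ℕ → ℕ) → (ℕ → ℕ) → ℕ → ℕ
(f ⋆ g) n = sum (applyUpTo (λ i → f i * g (n ∸ i)) (suc n))

⋆-congˡ : ∀ f {g h} n → (∀ i → g i ≡ h i) → (f ⋆ g) n ≡ (f ⋆ h) n
⋆-congˡ f n eq = sum-cong (suc n) λ i _ → cong (f i *_) (eq (n ∸ i))

⋆-congʳ : ∀ {f g} h n → (∀ i → f i ≡ g i) → (f ⋆ h) n ≡ (g ⋆ h) n
⋆-congʳ h n eq = sum-cong (suc n) λ i _ → cong (_* h (n ∸ i)) (eq i)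

-- Shaped for associativity: `(f ⋆ g) (suc i)` unfolds to `f 0 * g (suc i) + ((f ∘ suc) ⋆ g) i`.
⋆-linearʳ : ∀ a f g h n → ((λ i → a * f i + g i) ⋆ h) n ≡ a * (f ⋆ h) n + (g ⋆ h) n
⋆-linearʳ a f g h zero    = lemma a (f 0) (g 0) (h 0)
  where
  lemma : ∀ a f g h → (a * f + g) * h + 0 ≡ a * (f * h + 0) + (g * h + 0)
  lemma = solve-∀
⋆-linearʳ a f g h (suc n) =
  trans (cong ((a * f 0 + g 0) * h (suc n) +_) (⋆-linearʳ a (f ∘ suc) (g ∘ suc) h n))
        (lemma a (f 0) (g 0) (h (suc n)) _ _)
  where
  lemma : ∀ a f g h x y → (a * f + g) * h + (a * x + y) ≡ a * (f * h + x) + (g * h + y)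
  lemma = solve-∀

⋆-assoc : ∀ f g h n → ((f ⋆ g) ⋆ h) n ≡ (f ⋆ (g ⋆ h)) n
⋆-assoc f g h zero    = lemma (f 0) (g 0) (h 0)
  where
  lemma : ∀ f g h → (f * g + 0) * h + 0 ≡ f * (g * h + 0) + 0
  lemma = solve-∀
⋆-assoc f g h (suc n) = begin
  (f 0 * g 0 + 0) * h (suc n) + ((λ i → f 0 * g (suc i) + ((f ∘ suc) ⋆ g) i) ⋆ h) n
    ≡⟨ cong ((f 0 * g 0 + 0) * h (suc n) +_) (⋆-linearʳ (f 0) (g ∘ suc) ((f ∘ suc) ⋆ g) h n) ⟩
  (f 0 * g 0 + 0) * h (suc n) + (f 0 * ((g ∘ suc) ⋆ h) n + (((f ∘ suc) ⋆ g) ⋆ h) n)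
    ≡⟨ cong (λ z → (f 0 * g 0 + 0) * h (suc n) + (f 0 * ((g ∘ suc) ⋆ h) n + z))
         (⋆-assoc (f ∘ suc) g h n) ⟩
  (f 0 * g 0 + 0) * h (suc n) + (f 0 * ((g ∘ suc) ⋆ h) n + ((f ∘ suc) ⋆ (g ⋆ h)) n)
    ≡⟨ lemma (f 0) (g 0) (h (suc n)) _ _ ⟩
  f 0 * (g 0 * h (suc n) + ((g ∘ suc) ⋆ h) n) + ((f ∘ suc) ⋆ (g ⋆ h)) n ∎
  where
  open ≡-Reasoning
  lemma : ∀ f g h x y → (f * g + 0) * h + (f * x + y) ≡ f * (g * h + x) + y
  lemma = solve-∀

-- Unfolding splits off the first term of the sum; commutativity also needs the last one split off.
⋆-suc : ∀ f g n → (f ⋆ g) (suc n) ≡ g 0 * f (suc n) + (f ⋆ (g ∘ suc)) n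
⋆-suc f g zero    = lemma (f 0) (f 1) (g 0) (g 1)
  where
  lemma : ∀ f f′ g g′ → f * g′ + (f′ * g + 0) ≡ g * f′ + (f * g′ + 0)
  lemma = solve-∀
⋆-suc f g (suc n) = trans (cong (f 0 * g (2 + n) +_) (⋆-suc (f ∘ suc) g n))
  (lemma (f 0 * g (2 + n)) (g 0 * f (2 + n)) _)
  where
  lemma : ∀ x y z → x + (y + z) ≡ y + (x + z)
  lemma = solve-∀

⋆-comm : ∀ f g n → (f ⋆ g) n ≡ (g ⋆ f) n
⋆-comm f g zero    = cong (_+ 0) (*-comm (f 0) (g 0))
⋆-comm f g (suc n) =
  trans (cong (f 0 * g (suc n) +_) (⋆-comm (f ∘ suc) g n)) (sym (⋆-suc g f n))

⋆-leftComm : ∀ f g h n → (f ⋆ (g ⋆ h)) n ≡ (g ⋆ (f ⋆ h)) n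
⋆-leftComm f g h n = begin
  (f ⋆ (g ⋆ h)) n  ≡⟨ ⋆-assoc f g h n ⟨
  ((f ⋆ g) ⋆ h) n  ≡⟨ ⋆-congʳ h n (⋆-comm f g) ⟩
  ((g ⋆ f) ⋆ h) n  ≡⟨ ⋆-assoc g f h n ⟩
  (g ⋆ (f ⋆ h)) n  ∎
  where open ≡-Reasoning

-- For use with the counts of width 0 as `δ`: only the empty word has that width.
⋆-identityʳ : ∀ f δ n → δ 0 ≡ 1 → (∀ i → δ (suc i) ≡ 0) → (f ⋆ δ) n ≡ f n
⋆-identityʳ f δ zero    δ₀ δ₊ = begin
  f 0 * δ 0 + 0  ≡⟨ cong (λ z → f 0 * z + 0) δ₀ ⟩
  f 0 * 1 + 0    ≡⟨ trans (+-identityʳ _) (*-identityʳ _) ⟩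
  f 0            ∎
  where open ≡-Reasoning
⋆-identityʳ f δ (suc n) δ₀ δ₊ = begin
  f 0 * δ (suc n) + ((f ∘ suc) ⋆ δ) n
    ≡⟨ cong₂ (λ y z → f 0 * y + z) (δ₊ n) (⋆-identityʳ (f ∘ suc) δ n δ₀ δ₊) ⟩
  f 0 * 0 + f (suc n)
    ≡⟨ cong (_+ f (suc n)) (*-zeroʳ (f 0)) ⟩
  f (suc n) ∎
  where open ≡-Reasoning

-- Counting words with a decidable property

module _ (k n : ℕ) {P : Pred (Word k) 0ℓ} (P? : Decidable P) where

  #words-unique : Unique (filter P? (words k n))
  #words-unique = Unique.filter⁺ P? (words-unique k n)

  ∈-#words⁺ : ∀ {w} → length w ≡ n → P w → w ∈ filter P? (words k n)
  ∈-#words⁺ {w} refl p = ∈-filter⁺ P? (∈-words⁺ w) p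

  ∈-#words⁻ : ∀ {w} → w ∈ filter P? (words k n) → length w ≡ n × P w
  ∈-#words⁻ w∈ with w∈′ , p ← ∈-filter⁻ P? w∈ = ∈-words⁻ n w∈′ , p

  #words-none : (∀ {w} → length w ≡ n → ¬ P w) → #words k n P? ≡ 0
  #words-none none = cong length
    (filter-none P? (All.tabulate λ w∈ → none (∈-words⁻ n w∈)))

#words-cong : ∀ k n {P Q : Pred (Word k) 0ℓ} (P? : Decidable P) (Q? : Decidable Q) →
              (∀ {w} → length w ≡ n → P w → Q w) → (∀ {w} → length w ≡ n → Q w → P w) →
              #words k n P? ≡ #words k n Q?
#words-cong k n P? Q? to from = length-bijection id (#words-unique k n P?) (#words-unique k n Q?)
  (λ _ _ eq → eq)
  (λ w∈ → let l , p = ∈-#words⁻ k n P? w∈ in ∈-#words⁺ k n Q? l (to l p))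
  (λ w∈ → let l , q = ∈-#words⁻ k n Q? w∈ in _ , ∈-#words⁺ k n P? l (from l q) , refl)

-- Unlike u, this vanishes at n = 0, so the sums over i ≥ 1 become full convolutions.
#block : ℕ → ℕ → ℕ
#block k n = #words k n block?

#block-suc : ∀ k n → #block k (suc n) ≡ u k (suc n)
#block-suc k n = #words-cong k (suc n) block? unbordered? (λ _ → proj₂) 
  λ { {_ ∷ _} _ unb → (λ ()) , unb }

-- The recursion that peels off the outermost pair of blocks

module _ (k e t a : ℕ) where

  private
    -- Words have length `e + a * 2`, where `e` is the parity; this length remains between two outer
    -- blocks of length `i`.
    inner : ℕ → ℕ
    inner i = e + (a ∸ i) * 2

    row : ℕ → List (Word k × Word k)
    row i = cartesianProduct (filter block? (words k i)) (filter (largestWidth? t) (words k (inner i)))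

    pairs : List (Word k × Word k)
    pairs = concat (applyUpTo row (suc a))

    join : Word k × Word k → Word k
    join (b , v) = b ++ v ++ b

    InRow : ℕ → Word k × Word k → Set
    InRow i (b , v) = (length b ≡ i × Block b) × (length v ≡ inner i × LargestWidth t v)

    ∈-row⁻ : ∀ i {p} → p ∈ row i → InRow i p
    ∈-row⁻ i p∈ with b∈ , v∈ ← ∈-cartesianProduct⁻ (filter block? (words k i)) _ p∈ =
      ∈-#words⁻ k i block? b∈ , ∈-#words⁻ k (inner i) (largestWidth? t) v∈

    ∈-row⁺ : ∀ i {p} → InRow i p → p ∈ row i
    ∈-row⁺ i ((lb , B) , (lv , L)) =
      ∈-cartesianProduct⁺ (∈-#words⁺ k i block? lb B) (∈-#words⁺ k (inner i) (largestWidth? t) lv L)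

    ∈-pairs⁻ : ∀ {p} → p ∈ pairs → ∃[ i ] i ≤ a × InRow i p
    ∈-pairs⁻ p∈ with _ , p∈row , row∈ ← ∈-concat⁻′ (applyUpTo row (suc a)) p∈
      with i , s≤s i≤a , refl ← ∈-applyUpTo⁻ row row∈ = i , i≤a , ∈-row⁻ i p∈row

    ∈-pairs⁺ : ∀ {i p} → i ≤ a → InRow i p → p ∈ pairs
    ∈-pairs⁺ {i} i≤a r = ∈-concat⁺′ (∈-row⁺ i r) (∈-applyUpTo⁺ row (s≤s i≤a))

    pairs-unique : Unique pairs
    pairs-unique = Unique.concat⁺
      (All.applyUpTo⁺₂ row (suc a) λ i → Unique.cartesianProduct⁺
        (#words-unique k i block?) (#words-unique k (inner i) (largestWidth? t)))
      -- Distinct rows are disjoint, because the length of the outer block determines the row.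
      (AllPairs.applyUpTo⁺₁ row (suc a) λ {i} {j} i<j _ (p∈i , p∈j) →
        <⇒≢ i<j (trans (sym (proj₁ (proj₁ (∈-row⁻ i p∈i)))) (proj₁ (proj₁ (∈-row⁻ j p∈j)))))

    join-injective : ∀ {p q} → p ∈ pairs → q ∈ pairs → join p ≡ join q → p ≡ q
    join-injective p∈ q∈ eq
      with _ , _ , (_ , B) , _ ← ∈-pairs⁻ p∈ | _ , _ , (_ , C) , _ ← ∈-pairs⁻ q∈
      = ×-≡,≡→≡ (sandwich-injective B C eq)

    length-join : ∀ b v → length (join (b , v)) ≡ length v + length b * 2
    length-join b v = begin
      length (b ++ v ++ b)             ≡⟨ length-++ b ⟩
      length b + length (v ++ b)       ≡⟨ cong (length b +_) (length-++ v) ⟩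
      length b + (length v + length b) ≡⟨ lemma (length b) (length v) ⟩
      length v + length b * 2          ∎
      where
      open ≡-Reasoning
      lemma : ∀ b v → b + (v + b) ≡ v + b * 2
      lemma = solve-∀

    outer+inner : ∀ i → i ≤ a → inner i + i * 2 ≡ e + a * 2
    outer+inner i i≤a = begin
      e + (a ∸ i) * 2 + i * 2   ≡⟨ +-assoc e _ _ ⟩
      e + ((a ∸ i) * 2 + i * 2) ≡⟨ cong (e +_) (*-distribʳ-+ 2 (a ∸ i) i) ⟨
      e + (a ∸ i + i) * 2       ≡⟨ cong (λ z → e + z * 2) (m∸n+n≡m i≤a) ⟩
      e + a * 2                 ∎
      where open ≡-Reasoning

    join-∈ : ∀ {p} → p ∈ pairs → join p ∈ filter (largestWidth? (2 + t)) (words k (e + a * 2))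
    join-∈ {b , v} p∈ with i , i≤a , (refl , B) , (lv , L) ← ∈-pairs⁻ p∈ =
      ∈-#words⁺ k (e + a * 2) (largestWidth? (2 + t))
        (trans (length-join b v) (trans (cong (_+ length b * 2) lv) (outer+inner i i≤a)))
        (peeling⇒largest (wrap B (largest⇒peeling L) refl))

    join-onto : e < 2 → ∀ {w} → w ∈ filter (largestWidth? (2 + t)) (words k (e + a * 2)) →
                ∃[ p ] p ∈ pairs × w ≡ join p
    join-onto e<2 w∈ with lw , L ← ∈-#words⁻ k (e + a * 2) (largestWidth? (2 + t)) w∈
      with wrap {b = b} {v} B P refl ← largest⇒peeling L
      = (b , v) , ∈-pairs⁺ b≤a ((refl , B) , (lv , peeling⇒largest P)) , refl
      where
      len : length v + length b * 2 ≡ e + a * 2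
      len = trans (sym (length-join b v)) lw
      b≤a : length b ≤ a
      -- As `e` is at most 1, two blocks of length `suc a` would not fit into the word.
      b≤a = ≤-pred (*-cancelʳ-< 2 (length b) (suc a) (begin-strict
        length b * 2            ≤⟨ m≤n+m _ (length v) ⟩
        length v + length b * 2 ≡⟨ len ⟩
        e + a * 2               <⟨ +-monoˡ-< (a * 2) e<2 ⟩
        suc a * 2               ∎))
        where open ≤-Reasoning
      lv : length v ≡ inner (length b)
      lv = +-cancelʳ-≡ (length b * 2) _ _ (trans len (sym (outer+inner (length b) b≤a)))

  -- Gluing an unbordered block `b` around `v` is a bijection onto the words of largest width
  -- `2 + t`, and the row for length `i` is a product of two counts.
  IB-suc : e < 2 → IB k (e + a * 2) (2 + t) ≡ (#block k ⋆ λ c → IB k (e + c * 2) t) a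
  IB-suc e<2 = begin
    IB k (e + a * 2) (2 + t)
      ≡⟨ length-bijection join pairs-unique (#words-unique k (e + a * 2) (largestWidth? (2 + t)))
           join-injective join-∈ (join-onto e<2) ⟨
    length pairs
      ≡⟨ length-concat-applyUpTo row (suc a) ⟩
    sum (applyUpTo (length ∘ row) (suc a))
      ≡⟨ sum-cong (suc a) (λ i _ → length-cartesianProduct (filter block? (words k i))
           (filter (largestWidth? t) (words k (inner i)))) ⟩
    (#block k ⋆ λ c → IB k (e + c * 2) t) a ∎
    where open ≡-Reasoning

IB-width-1 : ∀ k n → IB k n 1 ≡ #block k n
IB-width-1 k n = #words-cong k n (largestWidth? 1) block?
  (λ _ → to ∘ largest⇒peeling) (λ _ B → peeling⇒largest (block B))
  where
  to : ∀ {w : Word k} → Peeling 1 w → Block w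
  to (block B) = B

IB-vanish : ∀ k {n t} → n < t → IB k n t ≡ 0
IB-vanish k {n} {t} n<t = #words-none k n (largestWidth? t)
  λ { refl (F , _ , refl) → contradiction (width≤length F) (<⇒≱ n<t) }

IB-odd-even : ∀ k n m → 2 ∤ n → IB k n (m * 2) ≡ 0
IB-odd-even k n m 2∤n = #words-none k n (largestWidth? (m * 2))
  λ { refl L → 2∤n (peeling-parity m (largest⇒peeling L)) }

IB-0-0 : ∀ k → IB k 0 0 ≡ 1
IB-0-0 k = cong length
  (filter-accept (largestWidth? {k} 0) {x = []} {xs = []} (peeling⇒largest empty))

IB-suc-0 : ∀ k n → IB k (suc n) 0 ≡ 0
IB-suc-0 k n = #words-none k (suc n) (largestWidth? 0) λ l L → none l (largest⇒peeling L)
  where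
  none : ∀ {w : Word k} → length w ≡ suc n → ¬ Peeling 0 w
  none () empty

-- The first factor counts cores, the second the coreless words formed by the `m` pairs of blocks.
-- In the induction each new pair puts `#block k` in front; it is moved past the cores and absorbed
-- into the second factor by `IB-suc` for even lengths.
IB-odd : ∀ k e m a → e < 2 →
         IB k (e + a * 2) (1 + m * 2) ≡
           ((λ c → #block k (e + c * 2)) ⋆ λ c → IB k (c * 2) (m * 2)) a
IB-odd k e zero    a e<2 = trans (IB-width-1 k (e + a * 2))
  (sym (⋆-identityʳ (λ c → #block k (e + c * 2)) (λ c → IB k (c * 2) 0) a
         (IB-0-0 k) (λ i → IB-suc-0 k (suc i * 2 ∸ 1))))
IB-odd k e (suc m) a e<2 = begin
  IB k (e + a * 2) (3 + m * 2)
    ≡⟨ IB-suc k e (1 + m * 2) a e<2 ⟩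
  (#block k ⋆ λ c → IB k (e + c * 2) (1 + m * 2)) a
    ≡⟨ ⋆-congˡ (#block k) a (λ c → IB-odd k e m c e<2) ⟩
  (#block k ⋆ (cores ⋆ λ c → IB k (c * 2) (m * 2))) a
    ≡⟨ ⋆-leftComm (#block k) cores (λ c → IB k (c * 2) (m * 2)) a ⟩
  (cores ⋆ (#block k ⋆ λ c → IB k (c * 2) (m * 2))) a
    ≡⟨ ⋆-congˡ cores a (λ c → IB-suc k 0 (m * 2) c (s≤s z≤n)) ⟨
  (cores ⋆ λ c → IB k (c * 2) (suc m * 2)) a ∎
  where
  open ≡-Reasoning
  cores : ℕ → ℕ
  cores c = #block k (e + c * 2)

-- Summation ranges and the parity cases

-- The omitted terms count words that are shorter than their width. This gives the upper limits of
-- the stated sums.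
∑₁-truncate : ∀ k (g : ℕ → ℕ) b m → ∑₁ b (λ i → g i * IB k ((b ∸ i) * 2) (m * 2))
                        ≡ ∑₁ (b ∸ m) (λ i → g i * IB k ((b ∸ i) * 2) (m * 2))
∑₁-truncate k g b m = sum-truncate (m∸n≤m b m) λ i b∸m≤i i<b →
  trans (cong (g (suc i) *_) (IB-vanish k (*-monoˡ-< 2 {b ∸ suc i} {m} (small i b∸m≤i i<b))))
        (*-zeroʳ (g (suc i)))
  where
  open ≤-Reasoning
  small : ∀ i → b ∸ m ≤ i → i < b → b ∸ suc i < m
  small i b∸m≤i i<b = begin-strict
    b ∸ suc i  <⟨ ∸-monoʳ-< (n<1+n i) i<b ⟩
    b ∸ i      ≤⟨ m≤n+o⇒m∸n≤o b i (≤-trans (m≤n+m∸n b m)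
                    (≤-trans (+-monoʳ-≤ m b∸m≤i) (≤-reflexive (+-comm m i)))) ⟩
    m          ∎

half-∸ : ∀ b m → (b * 2 ∸ m * 2) / 2 ≡ b ∸ m
half-∸ b m = trans (cong (_/ 2) (sym (*-distribʳ-∸ 2 b m))) (m*n/n≡m (b ∸ m) 2)

even⊎odd : ∀ n → (∃[ q ] n ≡ q * 2) ⊎ (∃[ q ] n ≡ 1 + q * 2)
even⊎odd zero = inj₁ (0 , refl)
even⊎odd (suc n) with even⊎odd n
... | inj₁ (q , refl) = inj₂ (q , refl)
... | inj₂ (q , refl) = inj₁ (suc q , refl)

odd : ∀ {n} → 2 ∤ n → ∃[ q ] n ≡ 1 + q * 2
odd {n} 2∤n with even⊎odd n
... | inj₁ (q , eq) = contradiction (divides q eq) 2∤n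
... | inj₂ p        = p

double-∸ : ∀ a i → a * 2 ∸ 2 * i ≡ (a ∸ i) * 2
double-∸ a i = trans (cong (a * 2 ∸_) (*-comm 2 i)) (sym (*-distribʳ-∸ 2 a i))

even-even : ∀ k a m →
  IB k (a * 2) (2 + m * 2) ≡
    ∑₁ ((a * 2 + 2 ∸ (2 + m * 2)) / 2) (λ i → u k i * IB k (a * 2 ∸ 2 * i) (m * 2))
even-even k a m = begin
  IB k (a * 2) (2 + m * 2)
    ≡⟨ IB-suc k 0 (m * 2) a (s≤s z≤n) ⟩
  -- The convolution also has a term at 0, which vanishes by computation since `#block k 0` reduces
  -- to 0.
  ∑₁ a (λ i → #block k i * IB k ((a ∸ i) * 2) (m * 2))
    ≡⟨ ∑₁-truncate k (#block k) a m ⟩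
  ∑₁ (a ∸ m) (λ i → #block k i * IB k ((a ∸ i) * 2) (m * 2))
    ≡⟨ sum-cong (a ∸ m) (λ i _ → cong₂ _*_ (#block-suc k i)
         (cong (λ z → IB k z (m * 2)) (sym (double-∸ a (suc i))))) ⟩
  ∑₁ (a ∸ m) summand
    ≡⟨ cong (λ N → ∑₁ N summand) (trans (cong (λ z → (z ∸ (2 + m * 2)) / 2) (+-comm (a * 2) 2))
         (half-∸ a m)) ⟨
  ∑₁ ((a * 2 + 2 ∸ (2 + m * 2)) / 2) summand ∎
  where
  open ≡-Reasoning
  summand : ℕ → ℕ
  summand i = u k i * IB k (a * 2 ∸ 2 * i) (m * 2)

even-odd : ∀ k a m →
  IB k (a * 2) (1 + m * 2) ≡
    ∑₁ ((a * 2 + 1 ∸ (1 + m * 2)) / 2) (λ i → u k (2 * i) * IB k (a * 2 ∸ 2 * i) (m * 2))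
even-odd k a m = begin
  IB k (a * 2) (1 + m * 2)
    ≡⟨ IB-odd k 0 m a (s≤s z≤n) ⟩
  ∑₁ a (λ i → #block k (i * 2) * IB k ((a ∸ i) * 2) (m * 2))
    ≡⟨ ∑₁-truncate k (λ i → #block k (i * 2)) a m ⟩
  ∑₁ (a ∸ m) (λ i → #block k (i * 2) * IB k ((a ∸ i) * 2) (m * 2))
    ≡⟨ sum-cong (a ∸ m) (λ i _ → cong₂ _*_
         (trans (#block-suc k (1 + i * 2)) (cong (u k) (*-comm (suc i) 2)))
         (cong (λ z → IB k z (m * 2)) (sym (double-∸ a (suc i))))) ⟩
  ∑₁ (a ∸ m) summand
    ≡⟨ cong (λ N → ∑₁ N summand) (trans (cong (λ z → (z ∸ (1 + m * 2)) / 2) (+-comm (a * 2) 1))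
         (half-∸ a m)) ⟨
  ∑₁ ((a * 2 + 1 ∸ (1 + m * 2)) / 2) summand ∎
  where
  open ≡-Reasoning
  summand : ℕ → ℕ
  summand i = u k (2 * i) * IB k (a * 2 ∸ 2 * i) (m * 2)

odd-odd : ∀ k a m → 1 ≤ m →
  IB k (1 + a * 2) (1 + m * 2) ≡
    ∑₁ ((1 + a * 2 + 2 ∸ (1 + m * 2)) / 2)
       (λ i → u k (2 * i ∸ 1) * IB k (1 + a * 2 ∸ 2 * i + 1) (m * 2))
odd-odd k a m 1≤m = begin
  IB k (1 + a * 2) (1 + m * 2)
    ≡⟨ IB-odd k 1 m a (s≤s (s≤s z≤n)) ⟩
  -- Cores have odd length `1 + c * 2`, so the term at `c = 0` stays; with `i = suc c` the index
  -- runs from 1 to `suc a`.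
  ∑₁ (suc a) (λ i → #block k (i * 2 ∸ 1) * IB k ((suc a ∸ i) * 2) (m * 2))
    ≡⟨ ∑₁-truncate k (λ i → #block k (i * 2 ∸ 1)) (suc a) m ⟩
  ∑₁ (suc a ∸ m) (λ i → #block k (i * 2 ∸ 1) * IB k ((suc a ∸ i) * 2) (m * 2))
    ≡⟨ sum-cong (suc a ∸ m) (λ i i< → cong₂ _*_
         (trans (#block-suc k (i * 2)) (cong (λ z → u k (z ∸ 1)) (*-comm (suc i) 2)))
         -- `1 ≤ m` keeps the summation index at most `a`. At `suc a` the subtraction would truncate
         -- and give length 1 in place of 0.
         (cong (λ z → IB k z (m * 2)) (sym (length≡ i (≤-trans i< (∸-monoʳ-≤ (suc a) 1≤m)))))) ⟩
  ∑₁ (suc a ∸ m) summand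
    ≡⟨ cong (λ N → ∑₁ N summand) (trans (cong (λ z → (z ∸ (1 + m * 2)) / 2) (+-comm (1 + a * 2) 2))
         (half-∸ (suc a) m)) ⟨
  ∑₁ ((1 + a * 2 + 2 ∸ (1 + m * 2)) / 2) summand ∎
  where
  open ≡-Reasoning
  summand : ℕ → ℕ
  summand i = u k (2 * i ∸ 1) * IB k (1 + a * 2 ∸ 2 * i + 1) (m * 2)
  length≡ : ∀ i → i < a → 1 + a * 2 ∸ 2 * suc i + 1 ≡ (a ∸ i) * 2
  length≡ i i<a = begin
    1 + a * 2 ∸ 2 * suc i + 1      ≡⟨ cong (λ z → 1 + a * 2 ∸ z + 1) (*-comm 2 (suc i)) ⟩
    1 + a * 2 ∸ suc i * 2 + 1      ≡⟨ cong (_+ 1) (+-∸-assoc 1 (*-monoˡ-≤ 2 i<a)) ⟩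
    1 + (a * 2 ∸ suc i * 2) + 1    ≡⟨ cong (λ z → 1 + z + 1) (*-distribʳ-∸ 2 a (suc i)) ⟨
    1 + (a ∸ suc i) * 2 + 1        ≡⟨ +-comm (1 + (a ∸ suc i) * 2) 1 ⟩
    suc (a ∸ suc i) * 2            ≡⟨ cong (_* 2) (+-∸-assoc 1 i<a) ⟨
    (a ∸ i) * 2                    ∎

theorem2 : (k : ℕ) → 2 ≤ k →
    IB k 0 0 ≡ 1
    × ((n : ℕ) → 1 ≤ n → IB k (2 * n) 2 ≡ u k n × IB k n 1 ≡ u k n)
    × ((n t : ℕ) → 3 ≤ t →
    (2 ∣ n → 2 ∣ t →
    IB k n t ≡ ∑₁ ((n + 2 ∸ t) / 2) (λ i → u k i * IB k (n ∸ 2 * i) (t ∸ 2)))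
    × (2 ∣ n → 2 ∤ t →
    IB k n t ≡ ∑₁ ((n + 1 ∸ t) / 2) (λ i → u k (2 * i) * IB k (n ∸ 2 * i) (t ∸ 1)))
    × (2 ∤ n → 2 ∣ t →
    IB k n t ≡ 0)
    × (2 ∤ n → 2 ∤ t →
    IB k n t ≡ ∑₁ ((n + 2 ∸ t) / 2) (λ i → u k (2 * i ∸ 1) * IB k (n ∸ 2 * i + 1) (t ∸ 1))))
theorem2 k _ = IB-0-0 k , small , λ n t 3≤t → ee 3≤t , eo , oe n , oo 3≤t
  where
  small : (n : ℕ) → 1 ≤ n → IB k (2 * n) 2 ≡ u k n × IB k n 1 ≡ u k n
  small (suc n) _ =
    (begin
      IB k (2 * suc n) 2
        ≡⟨ cong (λ z → IB k z 2) (*-comm 2 (suc n)) ⟩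
      IB k (suc n * 2) 2
        ≡⟨ IB-suc k 0 0 (suc n) (s≤s z≤n) ⟩
      (#block k ⋆ λ c → IB k (c * 2) 0) (suc n)
        ≡⟨ ⋆-identityʳ (#block k) (λ c → IB k (c * 2) 0) (suc n)
             (IB-0-0 k) (λ i → IB-suc-0 k (suc i * 2 ∸ 1)) ⟩
      #block k (suc n)
        ≡⟨ #block-suc k n ⟩
      u k (suc n) ∎) ,
    trans (IB-width-1 k (suc n)) (#block-suc k n)
    where open ≡-Reasoning
  ee : ∀ {n t} → 3 ≤ t → 2 ∣ n → 2 ∣ t → _
  ee _ (divides a refl) (divides (suc m) refl) = even-even k a m
  eo : ∀ {n t} → 2 ∣ n → 2 ∤ t → _
  eo (divides a refl) 2∤t with m , refl ← odd 2∤t = even-odd k a m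
  oe : ∀ n {t} → 2 ∤ n → 2 ∣ t → IB k n t ≡ 0
  oe n 2∤n (divides m refl) = IB-odd-even k n m 2∤n
  oo : ∀ {n t} → 3 ≤ t → 2 ∤ n → 2 ∤ t → _
  oo 3≤t 2∤n 2∤t with a , refl ← odd 2∤n | odd 2∤t
  -- An odd `t` with `3 ≤ t` is `1 + m * 2` for a positive `m`, as `odd-odd` demands.
  ... | suc m , refl = odd-odd k a (suc m) (s≤s z≤n)
  ... | zero , refl with s≤s () ← 3≤t
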